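{- For each positive integer $n$, there exists a matrix $M\in\mathbb{R}_+^{2^n\times 2^n}$ with $\operatorname{rank}_+(M)=2^{\Omega(n)}$ and $\operatorname{rank}_{\mathrm{PSD}}(M)=O(n)$. (The constants in $\Omega(n)$ and $O(n)$ are independent of $n$.)
   Context: The nonnegative rank $\operatorname{rank}_+(M)$ of a nonnegative matrix $M$ is the smallest $r$ such that $M=TU$ with $T$ and $U$ entrywise nonnegative real matrices, $T$ having $r$ columns and $U$ having $r$ rows. The PSD rank $\operatorname{rank}_{\mathrm{PSD}}(M)$ of an $m\times n'$ matrix $M$ is the smallest $r$ such that there exist $r\times r$ real symmetric positive semidefinite matrices $T_1,\ldots,T_m$ and $U^1,\ldots,U^{n'}$ with $\operatorname{Tr}[T_iU^j]=M_{ij}$ for all $i,j$. "$=2^{\Omega(n)}$" means at least $2^{cn}$ for some constant $c>0$ and all sufficiently large $n$. -}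

module Defs where

open import Algebra.Bundles.Raw using (RawRing)
import Algebra.Definitions.RawMonoid as RawMonoidDefinitions
open import Data.Fin.Base using (Fin)
open import Data.Nat.Base as ℕ using (ℕ; _⊔_; _^_)
open import Data.Nat.Induction using (<-rec)
import Data.Nat.Properties as ℕ
open import Data.Product using (∃; ∃-syntax; _×_; _,_)
open import Data.Rational.Base as ℚ
  using (ℚ; 0ℚ; 1ℚ; ½; ∣_∣; Positive)
import Data.Rational.Properties as ℚ
open import Data.Rational.Solver using (module +-*-Solver)
open import Data.Vec.Functional using (Vector)
open import Function.Bundles using (_⇔_; mk⇔)
open import Level using (0ℓ)
open import Relation.Binary.PropositionalEquality
  using (_≡_; refl; sym; trans; cong; subst)
open import Relation.Nullary using (¬_)

-- The real numbers are Cauchy sequences of rationals, considered up to _≃_.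

IsCauchy : (ℕ → ℚ) → Set
IsCauchy s = ∀ ε → .{{Positive ε}} →
  ∃[ N ] ∀ m n → N ℕ.≤ m → N ℕ.≤ n → ∣ s m ℚ.- s n ∣ ℚ.< ε

record ℝ : Set where
  constructor mkℝ
  field
    seq    : ℕ → ℚ
    cauchy : IsCauchy seq

open ℝ public

infix 4 _≃_ _≤_

_≃_ : ℝ → ℝ → Set
x ≃ y = ∀ ε → .{{Positive ε}} →
  ∃[ N ] ∀ n → N ℕ.≤ n → ∣ seq x n ℚ.- seq y n ∣ ℚ.< ε

-- The slack ε is essential: seq x n ≤ seq y n for all large n would not
-- respect _≃_.
_≤_ : ℝ → ℝ → Set
x ≤ y = ∀ ε → .{{Positive ε}} →
  ∃[ N ] ∀ n → N ℕ.≤ n → seq x n ℚ.< seq y n ℚ.+ ε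

private
  positive-½* : ∀ ε → .{{Positive ε}} → Positive (½ ℚ.* ε)
  positive-½* ε = ℚ.pos*pos⇒pos ½ ε

  halves : ∀ ε → ½ ℚ.* ε ℚ.+ ½ ℚ.* ε ≡ ε
  halves ε = trans (sym (ℚ.*-distribʳ-+ ε ½ ½)) (ℚ.*-identityˡ ε)

  abstract
    cauchy-const : ∀ q → IsCauchy (λ _ → q)
    cauchy-const q ε = 0 , λ _ _ _ _ →
      subst (λ d → ∣ d ∣ ℚ.< ε) (sym (ℚ.+-inverseʳ q)) (ℚ.positive⁻¹ ε)

    cauchy-neg : ∀ {s} → IsCauchy s → IsCauchy (λ n → ℚ.- s n)
    cauchy-neg {s} cs ε with N , h ← cs ε = N , λ m n N≤m N≤n →
      subst (ℚ._< ε)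
        (trans (sym (ℚ.∣-p∣≡∣p∣ (s m ℚ.- s n)))
               (cong ∣_∣ (ℚ.neg-distrib-+ (s m) (ℚ.- s n))))
        (h m n N≤m N≤n)

    cauchy-+ : ∀ {s t} → IsCauchy s → IsCauchy t → IsCauchy (λ n → s n ℚ.+ t n)
    cauchy-+ {s} {t} cs ct ε
      with N₁ , h₁ ← cs (½ ℚ.* ε) {{positive-½* ε}}
      with N₂ , h₂ ← ct (½ ℚ.* ε) {{positive-½* ε}}
      = N₁ ⊔ N₂ , λ m n N≤m N≤n → begin-strict
        ∣ (s m ℚ.+ t m) ℚ.- (s n ℚ.+ t n) ∣
          ≡⟨ cong ∣_∣ (rearrange (s m) (t m) (s n) (t n)) ⟩
        ∣ (s m ℚ.- s n) ℚ.+ (t m ℚ.- t n) ∣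
          ≤⟨ ℚ.∣p+q∣≤∣p∣+∣q∣ (s m ℚ.- s n) (t m ℚ.- t n) ⟩
        ∣ s m ℚ.- s n ∣ ℚ.+ ∣ t m ℚ.- t n ∣
          <⟨ ℚ.+-mono-<
               (h₁ m n (ℕ.m⊔n≤o⇒m≤o N₁ N₂ N≤m) (ℕ.m⊔n≤o⇒m≤o N₁ N₂ N≤n))
               (h₂ m n (ℕ.m⊔n≤o⇒n≤o N₁ N₂ N≤m) (ℕ.m⊔n≤o⇒n≤o N₁ N₂ N≤n)) ⟩
        ½ ℚ.* ε ℚ.+ ½ ℚ.* ε
          ≡⟨ halves ε ⟩
        ε ∎
      where
      open ℚ.≤-Reasoning
      open +-*-Solver
      rearrange : ∀ a b c d →
        (a ℚ.+ b) ℚ.- (c ℚ.+ d) ≡ (a ℚ.- c) ℚ.+ (b ℚ.- d)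
      rearrange = solve 4
        (λ a b c d → (a :+ b) :- (c :+ d) := (a :- c) :+ (b :- d)) refl

    eventually-bounded : ∀ {s} → IsCauchy s →
      ∃[ B ] Positive B × ∃[ N ] ∀ n → N ℕ.≤ n → ∣ s n ∣ ℚ.≤ B
    eventually-bounded {s} cs with N , h ← cs 1ℚ =
      1ℚ ℚ.+ ∣ s N ∣ ,
      ℚ.pos+nonNeg⇒pos 1ℚ ∣ s N ∣ {{ℚ.∣-∣-nonNeg (s N)}} ,
      N , λ n N≤n → begin
        ∣ s n ∣
          ≡⟨ cong ∣_∣ (split (s n) (s N)) ⟩
        ∣ (s n ℚ.- s N) ℚ.+ s N ∣
          ≤⟨ ℚ.∣p+q∣≤∣p∣+∣q∣ (s n ℚ.- s N) (s N) ⟩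
        ∣ s n ℚ.- s N ∣ ℚ.+ ∣ s N ∣
          ≤⟨ ℚ.+-monoˡ-≤ ∣ s N ∣ (ℚ.<⇒≤ (h n N N≤n ℕ.≤-refl)) ⟩
        1ℚ ℚ.+ ∣ s N ∣ ∎
      where
      open ℚ.≤-Reasoning
      open +-*-Solver
      split : ∀ a b → a ≡ (a ℚ.- b) ℚ.+ b
      split = solve 2 (λ a b → a := (a :- b) :+ b) refl

    scaled : ∀ B → .{{Positive B}} → ℚ → ℚ
    scaled B ε = (ℚ.1/ B) {{ℚ.pos⇒nonZero B}} ℚ.* ε

    scaled>0 : ∀ B → .{{_ : Positive B}} → ∀ ε → .{{Positive ε}} →
      Positive (scaled B ε)
    scaled>0 B ε =
      ℚ.pos*pos⇒pos ((ℚ.1/ B) {{ℚ.pos⇒nonZero B}}) {{ℚ.1/pos⇒pos B}} ε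

    product-small : ∀ a d B ε → .{{_ : Positive B}} →
      ∣ a ∣ ℚ.≤ B → ∣ d ∣ ℚ.< scaled B ε → ∣ a ℚ.* d ∣ ℚ.< ε
    product-small a d B ε |a|≤B |d|< = begin-strict
      ∣ a ℚ.* d ∣
        ≡⟨ ℚ.∣p*q∣≡∣p∣*∣q∣ a d ⟩
      ∣ a ∣ ℚ.* ∣ d ∣
        ≤⟨ ℚ.*-monoʳ-≤-nonNeg ∣ d ∣ {{ℚ.∣-∣-nonNeg d}} |a|≤B ⟩
      B ℚ.* ∣ d ∣
        <⟨ ℚ.*-monoʳ-<-pos B |d|< ⟩
      B ℚ.* (1/B ℚ.* ε)
        ≡⟨ ℚ.*-assoc B 1/B ε ⟨
      (B ℚ.* 1/B) ℚ.* ε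
        ≡⟨ cong (ℚ._* ε) (ℚ.*-inverseʳ B {{ℚ.pos⇒nonZero B}}) ⟩
      1ℚ ℚ.* ε
        ≡⟨ ℚ.*-identityˡ ε ⟩
      ε ∎
      where
      open ℚ.≤-Reasoning
      1/B : ℚ
      1/B = (ℚ.1/ B) {{ℚ.pos⇒nonZero B}}

    *-difference : ∀ a b c d →
      a ℚ.* b ℚ.- c ℚ.* d ≡ a ℚ.* (b ℚ.- d) ℚ.+ d ℚ.* (a ℚ.- c)
    *-difference = solve 4
      (λ a b c d → a :* b :- c :* d := a :* (b :- d) :+ d :* (a :- c)) refl
      where open +-*-Solver

    product-close : ∀ a b c d A B ε → .{{_ : Positive A}} .{{_ : Positive B}} →
      ∣ a ∣ ℚ.≤ A → ∣ d ∣ ℚ.≤ B →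
      ∣ a ℚ.- c ∣ ℚ.< scaled B (½ ℚ.* ε) → ∣ b ℚ.- d ∣ ℚ.< scaled A (½ ℚ.* ε) →
      ∣ a ℚ.* b ℚ.- c ℚ.* d ∣ ℚ.< ε
    product-close a b c d A B ε |a|≤A |d|≤B |a-c|< |b-d|< = begin-strict
      ∣ a ℚ.* b ℚ.- c ℚ.* d ∣
        ≡⟨ cong ∣_∣ (*-difference a b c d) ⟩
      ∣ a ℚ.* (b ℚ.- d) ℚ.+ d ℚ.* (a ℚ.- c) ∣
        ≤⟨ ℚ.∣p+q∣≤∣p∣+∣q∣ (a ℚ.* (b ℚ.- d)) (d ℚ.* (a ℚ.- c)) ⟩
      ∣ a ℚ.* (b ℚ.- d) ∣ ℚ.+ ∣ d ℚ.* (a ℚ.- c) ∣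
        <⟨ ℚ.+-mono-< (product-small a (b ℚ.- d) A (½ ℚ.* ε) |a|≤A |b-d|<)
                      (product-small d (a ℚ.- c) B (½ ℚ.* ε) |d|≤B |a-c|<) ⟩
      ½ ℚ.* ε ℚ.+ ½ ℚ.* ε
        ≡⟨ halves ε ⟩
      ε ∎
      where open ℚ.≤-Reasoning

    cauchy-* : ∀ {s t} → IsCauchy s → IsCauchy t → IsCauchy (λ n → s n ℚ.* t n)
    cauchy-* {s} {t} cs ct ε =
      let A , A>0 , K , |s|≤A = eventually-bounded {s} cs
          B , B>0 , L , |t|≤B = eventually-bounded {t} ct
          η = ½ ℚ.* ε
          N₁ , h₁ = cs (scaled B {{B>0}} η) {{scaled>0 B {{B>0}} η {{positive-½* ε}}}}
          N₂ , h₂ = ct (scaled A {{A>0}} η) {{scaled>0 A {{A>0}} η {{positive-½* ε}}}}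
      in (K ⊔ L) ⊔ (N₁ ⊔ N₂) , λ m n N≤m N≤n →
        let K⊔L≤m = ℕ.m⊔n≤o⇒m≤o (K ⊔ L) (N₁ ⊔ N₂) N≤m
            K⊔L≤n = ℕ.m⊔n≤o⇒m≤o (K ⊔ L) (N₁ ⊔ N₂) N≤n
            N₁⊔N₂≤m = ℕ.m⊔n≤o⇒n≤o (K ⊔ L) (N₁ ⊔ N₂) N≤m
            N₁⊔N₂≤n = ℕ.m⊔n≤o⇒n≤o (K ⊔ L) (N₁ ⊔ N₂) N≤n
        in product-close (s m) (t m) (s n) (t n) A B ε {{A>0}} {{B>0}}
          (|s|≤A m (ℕ.m⊔n≤o⇒m≤o K L K⊔L≤m))
          (|t|≤B n (ℕ.m⊔n≤o⇒n≤o K L K⊔L≤n))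
          (h₁ m n (ℕ.m⊔n≤o⇒m≤o N₁ N₂ N₁⊔N₂≤m) (ℕ.m⊔n≤o⇒m≤o N₁ N₂ N₁⊔N₂≤n))
          (h₂ m n (ℕ.m⊔n≤o⇒n≤o N₁ N₂ N₁⊔N₂≤m) (ℕ.m⊔n≤o⇒n≤o N₁ N₂ N₁⊔N₂≤n))

fromℚ : ℚ → ℝ
fromℚ q = mkℝ (λ _ → q) (cauchy-const q)

0ℝ 1ℝ : ℝ
0ℝ = fromℚ 0ℚ
1ℝ = fromℚ 1ℚ

infix  8 -_
infixl 7 _*_
infixl 6 _+_

-_ : ℝ → ℝ
- x = mkℝ (λ n → ℚ.- seq x n) (cauchy-neg {seq x} (cauchy x))

_+_ _*_ : ℝ → ℝ → ℝ
x + y = mkℝ (λ n → seq x n ℚ.+ seq y n) (cauchy-+ {seq x} {seq y} (cauchy x) (cauchy y))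
x * y = mkℝ (λ n → seq x n ℚ.* seq y n) (cauchy-* {seq x} {seq y} (cauchy x) (cauchy y))

ℝ-rawRing : RawRing 0ℓ 0ℓ
ℝ-rawRing = record
  { Carrier = ℝ
  ; _≈_     = _≃_
  ; _+_     = _+_
  ; _*_     = _*_
  ; -_      = -_
  ; 0#      = 0ℝ
  ; 1#      = 1ℝ
  }

open RawMonoidDefinitions (RawRing.+-rawMonoid ℝ-rawRing) public using (sum)

Matrix : ℕ → ℕ → Set
Matrix m n = Fin m → Fin n → ℝ

infixl 7 _⊗_

_⊗_ : ∀ {m k n} → Matrix m k → Matrix k n → Matrix m n
(A ⊗ B) i j = sum λ l → A i l * B l j

trace : ∀ {n} → Matrix n n → ℝ
trace A = sum λ i → A i i

Nonnegative : ∀ {m n} → Matrix m n → Set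
Nonnegative A = ∀ i j → 0ℝ ≤ A i j

Symmetric : ∀ {n} → Matrix n n → Set
Symmetric A = ∀ i j → A i j ≃ A j i

PositiveSemidefinite : ∀ {n} → Matrix n n → Set
PositiveSemidefinite {n} A =
  Symmetric A × (∀ (x : Vector ℝ n) → 0ℝ ≤ sum λ i → sum λ j → x i * A i j * x j)

record NonnegativeFactorization {m n} (M : Matrix m n) (r : ℕ) : Set where
  field
    T             : Matrix m r
    U             : Matrix r n
    T-nonnegative : Nonnegative T
    U-nonnegative : Nonnegative U
    factorizes    : ∀ i j → M i j ≃ (T ⊗ U) i j

record PSDFactorization {m n} (M : Matrix m n) (r : ℕ) : Set where
  field
    T          : Fin m → Matrix r r
    U          : Fin n → Matrix r r
    T-psd      : ∀ i → PositiveSemidefinite (T i)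
    U-psd      : ∀ j → PositiveSemidefinite (U j)
    factorizes : ∀ i j → trace (T i ⊗ U j) ≃ M i j

IsLeast : (ℕ → Set) → ℕ → Set
IsLeast P r = P r × (∀ s → P s → r ℕ.≤ s)

IsRank₊ IsRankPSD : ∀ {m n} → Matrix m n → ℕ → Set
IsRank₊   M = IsLeast (NonnegativeFactorization M)
IsRankPSD M = IsLeast (PSDFactorization M)

-- The least size of a factorization cannot in general be computed
-- constructively, so the ranks (IsRank₊, IsRankPSD) are relations rather than
-- functions, and a bound on a rank is expressed by quantifying over
-- factorizations.  The bounds say exactly what they should about the least
-- element whenever there is one (k≤min^q⇔, min≤k⇔), and classically there is
-- one whenever P is inhabited (¬¬-least).

infix 4 _≤min[_]^_ min[_]≤_ _≤rank₊[_]^_ rankPSD[_]≤_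

_≤min[_]^_ : ℕ → (ℕ → Set) → ℕ → Set
k ≤min[ P ]^ q = ∀ r → P r → k ℕ.≤ r ^ q

min[_]≤_ : (ℕ → Set) → ℕ → Set
min[ P ]≤ k = ∃[ r ] P r × r ℕ.≤ k

k≤min^q⇔ : ∀ {P r} → IsLeast P r → ∀ k q → k ≤min[ P ]^ q ⇔ k ℕ.≤ r ^ q
k≤min^q⇔ {r = r} (pr , least) k q = mk⇔
  (λ h → h r pr)
  (λ k≤ s ps → ℕ.≤-trans k≤ (ℕ.^-monoˡ-≤ q (least s ps)))

min≤k⇔ : ∀ {P r} → IsLeast P r → ∀ k → min[ P ]≤ k ⇔ r ℕ.≤ k
min≤k⇔ {r = r} (pr , least) k = mk⇔
  (λ (s , ps , s≤k) → ℕ.≤-trans (least s ps) s≤k)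
  (λ r≤k → r , pr , r≤k)

¬¬-least : ∀ {P} → ∃ P → ¬ ¬ ∃ (IsLeast P)
¬¬-least {P} (r , pr) none = <-rec (λ n → ¬ P n)
  (λ n smaller pn → none
    (n , pn , λ s ps → ℕ.≮⇒≥ λ s<n → smaller s<n ps))
  r pr

_≤rank₊[_]^_ : ∀ {m n} → ℕ → Matrix m n → ℕ → Set
k ≤rank₊[ M ]^ q = k ≤min[ NonnegativeFactorization M ]^ q

rankPSD[_]≤_ : ∀ {m n} → Matrix m n → ℕ → Set
rankPSD[ M ]≤ k = min[ PSDFactorization M ]≤ k

MatrixFamily : Set
MatrixFamily = ∀ n → .{{ℕ.NonZero n}} → Matrix (2 ^ n) (2 ^ n)

-- 2 ^ (c n) ≤ rank₊(Mₙ) for all large n and some c > 0.  It is no restriction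
-- to take c = a / b rational, and then the inequality is
-- 2 ^ (a n) ≤ rank₊(Mₙ) ^ b.
Rank₊=2^Ω[n] : MatrixFamily → Set
Rank₊=2^Ω[n] M =
  ∃[ a ] ∃[ b ] ∃[ n₀ ] ℕ.NonZero a × ℕ.NonZero b ×
    (∀ n → .{{_ : ℕ.NonZero n}} → n₀ ℕ.≤ n → 2 ^ (a ℕ.* n) ≤rank₊[ M n ]^ b)

RankPSD=O[n] : MatrixFamily → Set
RankPSD=O[n] M =
  ∃[ C ] ∃[ n₀ ]
    (∀ n → .{{_ : ℕ.NonZero n}} → n₀ ℕ.≤ n → rankPSD[ M n ]≤ C ℕ.* n)

-- The matrix is M(a,b) = (1 − a·b)² for a, b ∈ {0,1}ⁿ.  It is the square of
-- the inner product of (1,−a) and (1,b), so rank-one matrices of size n + 1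
-- give a PSD factorization.
--
-- For the nonnegative rank, let r be the inner dimension of a nonnegative
-- factorization of M.  The supports of its r rank-one summands are rectangles
-- which together cover every disjoint pair (where M = 1) and contain no pair
-- meeting in exactly one element (where M = 0).  By an induction due to Kaibel
-- and Weltge such a rectangle contains at most 2ⁿ of the 3ⁿ disjoint pairs, so
-- 3ⁿ ≤ r 2ⁿ, whence 2ⁿ ≤ (9/4)ⁿ ≤ r².

module Submission where

open import Defs
open import Algebra.Bundles using (CommutativeRing)
import Algebra.Properties.CommutativeSemigroup as CommutativeSemigroupProperties
import Algebra.Properties.Ring as RingProperties
import Algebra.Properties.Semiring.Sum as SemiringSum
open import Data.Bool.Base using (Bool; true; false; T; _∧_; _∨_)
open import Data.Empty using (⊥; ⊥-elim)
open import Data.Fin.Base using (Fin; zero; suc; finToFun; funToFin)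
open import Data.Fin.Patterns using (0F; 1F)
open import Data.Fin.Properties using (any?; finToFun-funToFin; sequence)
open import Data.Nat.Base as ℕ using (ℕ; zero; suc; _^_; NonZero; z≤n; s≤s)
import Data.Nat.Properties as ℕ
import Data.Nat.Solver as ℕ
open import Data.Product using (Σ-syntax; ∃-syntax; _×_; _,_)
open import Data.Rational.Base as ℚ using (ℚ; 0ℚ; 1ℚ; ½; ∣_∣; Positive)
import Data.Rational.Properties as ℚ
import Data.Rational.Solver as ℚ
open import Data.Sum.Base using (_⊎_; inj₁; inj₂; [_,_]′)
open import Data.Vec.Functional using (Vector; _∷_; [])
open import Effect.Monad using (RawMonad)
open import Function.Base using (_∘_)
open import Relation.Binary.PropositionalEquality
open import Relation.Nullary using (¬_; Dec; yes; no)
open import Relation.Nullary.Decidable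
  using (does; decidable-stable; ¬¬-excluded-middle; _×-dec_)
open import Relation.Nullary.Negation using (¬¬-Monad)

module ℚ-ring = CommutativeRing ℚ.+-*-commutativeRing
open SemiringSum ℚ-ring.semiring
  using (*-distribˡ-sum; *-distribʳ-sum; sum-cong-≗)
  renaming (sum to sumℚ)

-- Rational vectors and rank-one matrices

infix 9 _·_

_·_ : ∀ {n} → Vector ℚ n → Vector ℚ n → ℚ
x · y = sumℚ λ i → x i ℚ.* y i

·-comm : ∀ {n} (x y : Vector ℚ n) → x · y ≡ y · x
·-comm x y = sum-cong-≗ λ i → ℚ.*-comm (x i) (y i)

·-negˡ : ∀ {n} (x y : Vector ℚ n) → (ℚ.-_ ∘ x) · y ≡ ℚ.- x · y
·-negˡ x y = begin
  (ℚ.-_ ∘ x) · y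
    ≡⟨ sum-cong-≗ (λ i → trans (sym (ℚ.neg-distribˡ-* (x i) (y i)))
                               (neg≡-1* (x i ℚ.* y i))) ⟩
  sumℚ (λ i → ℚ.- 1ℚ ℚ.* (x i ℚ.* y i))
    ≡⟨ *-distribˡ-sum (ℚ.- 1ℚ) (λ i → x i ℚ.* y i) ⟨
  ℚ.- 1ℚ ℚ.* x · y
    ≡⟨ neg≡-1* (x · y) ⟨
  ℚ.- x · y ∎
  where
  open ≡-Reasoning
  neg≡-1* : ∀ p → ℚ.- p ≡ ℚ.- 1ℚ ℚ.* p
  neg≡-1* p = sym (RingProperties.-1*x≈-x ℚ-ring.ring p)

sum-*-sum : ∀ {m n} (f : Vector ℚ m) (g : Vector ℚ n) →
  sumℚ f ℚ.* sumℚ g ≡ sumℚ λ i → sumℚ λ j → f i ℚ.* g j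
sum-*-sum f g = trans (*-distribʳ-sum (sumℚ g) f)
  (sum-cong-≗ λ i → *-distribˡ-sum (f i) g)

0≤p*p : ∀ p → 0ℚ ℚ.≤ p ℚ.* p
0≤p*p p = subst (0ℚ ℚ.≤_) (|p|*|p| p) (ℚ.nonNegative⁻¹ _
  {{ℚ.nonNeg*nonNeg⇒nonNeg (∣ p ∣) {{ℚ.∣-∣-nonNeg p}} (∣ p ∣) {{ℚ.∣-∣-nonNeg p}}}})
  where
  open ℚ.+-*-Solver
  |p|*|p| : ∀ p → ∣ p ∣ ℚ.* ∣ p ∣ ≡ p ℚ.* p
  |p|*|p| p with ℚ.∣p∣≡p∨∣p∣≡-p p
  ... | inj₁ eq rewrite eq = refl
  ... | inj₂ eq rewrite eq = solve 1 (λ p → :- p :* :- p := p :* p) refl p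

-- Addition and multiplication of reals act termwise on the sequences, so claims about sums of reals
-- reduce to rational ones at each index `k`.
seq-sum : ∀ {n} (f : Vector ℝ n) k → seq (sum f) k ≡ sumℚ λ i → seq (f i) k
seq-sum {zero}  f k = refl
seq-sum {suc n} f k = cong (seq (f zero) k ℚ.+_) (seq-sum (f ∘ suc) k)

seq-sum² : ∀ {m n} (f : Fin m → Vector ℝ n) k →
  seq (sum λ i → sum λ j → f i j) k ≡ sumℚ λ i → sumℚ λ j → seq (f i j) k
seq-sum² f k = trans (seq-sum (λ i → sum λ j → f i j) k)
                     (sum-cong-≗ λ i → seq-sum (f i) k)

pointwise⇒≃ : ∀ {x y} → (∀ n → seq x n ≡ seq y n) → x ≃ y
pointwise⇒≃ {x} {y} eq ε = 0 , λ n _ →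
  subst (λ d → ∣ d ∣ ℚ.< ε)
    (sym (trans (cong (ℚ._- seq y n) (eq n)) (ℚ.+-inverseʳ (seq y n))))
    (ℚ.positive⁻¹ ε)

pointwise⇒0≤ : ∀ {x} → (∀ n → 0ℚ ℚ.≤ seq x n) → 0ℝ ≤ x
pointwise⇒0≤ 0≤x ε = 0 , λ n _ → ℚ.+-mono-≤-< (0≤x n) (ℚ.positive⁻¹ ε)

outer : ∀ {n} → Vector ℚ n → Matrix n n
outer v i j = fromℚ (v i ℚ.* v j)

open CommutativeSemigroupProperties
  (CommutativeRing.*-commutativeSemigroup ℚ.+-*-commutativeRing)
  using (interchange)

-- At every index of the sequences, the quadratic form of `outer v` at `x` is the square of the
-- inner product of `x` and `v`.
outer-psd : ∀ {n} (v : Vector ℚ n) → PositiveSemidefinite (outer v)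
outer-psd v =
    (λ i j → pointwise⇒≃ {outer v i j} {outer v j i} λ _ → ℚ.*-comm (v i) (v j))
  , λ x → pointwise⇒0≤ {sum λ i → sum λ j → x i * outer v i j * x j} λ k →
      let xₖ = λ i → seq (x i) k in
      subst (0ℚ ℚ.≤_) (begin
        xₖ · v ℚ.* xₖ · v
          ≡⟨ cong ((xₖ · v) ℚ.*_) (·-comm xₖ v) ⟩
        xₖ · v ℚ.* v · xₖ
          ≡⟨ sum-*-sum (λ i → xₖ i ℚ.* v i) (λ j → v j ℚ.* xₖ j) ⟩
        sumℚ (λ i → sumℚ λ j → xₖ i ℚ.* v i ℚ.* (v j ℚ.* xₖ j))
          ≡⟨ sum-cong-≗ (λ i → sum-cong-≗ λ j →
               reassociate (xₖ i) (v i) (v j) (xₖ j)) ⟩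
        sumℚ (λ i → sumℚ λ j → xₖ i ℚ.* (v i ℚ.* v j) ℚ.* xₖ j)
          ≡⟨ seq-sum² (λ i j → x i * outer v i j * x j) k ⟨
        seq (sum λ i → sum λ j → x i * outer v i j * x j) k ∎)
      (0≤p*p (xₖ · v))
  where
  open ≡-Reasoning
  reassociate : ∀ a b c d → a ℚ.* b ℚ.* (c ℚ.* d) ≡ a ℚ.* (b ℚ.* c) ℚ.* d
  reassociate a b c d = trans (sym (ℚ.*-assoc (a ℚ.* b) c d))
    (cong (ℚ._* d) (ℚ.*-assoc a b c))

-- The double sum regroups into products of `v i * w i` with `v l * w l` and therefore factors.
trace-outer : ∀ {n} (v w : Vector ℚ n) →
  trace (outer v ⊗ outer w) ≃ fromℚ (v · w ℚ.* v · w)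
trace-outer v w =
  pointwise⇒≃ {trace (outer v ⊗ outer w)} {fromℚ (v · w ℚ.* v · w)} λ k → begin
    seq (trace (outer v ⊗ outer w)) k
      ≡⟨ seq-sum² (λ i l → outer v i l * outer w l i) k ⟩
    sumℚ (λ i → sumℚ λ l → v i ℚ.* v l ℚ.* (w l ℚ.* w i))
      ≡⟨ sum-cong-≗ (λ i → sum-cong-≗ λ l →
           trans (cong (v i ℚ.* v l ℚ.*_) (ℚ.*-comm (w l) (w i)))
                 (interchange (v i) (v l) (w i) (w l))) ⟩
    sumℚ (λ i → sumℚ λ l → v i ℚ.* w i ℚ.* (v l ℚ.* w l))
      ≡⟨ sum-*-sum (λ i → v i ℚ.* w i) (λ l → v l ℚ.* w l) ⟨
    v · w ℚ.* v · w ∎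
  where open ≡-Reasoning

-- Rectangles of pairs of subsets

-- Using `Fin 2` lets `finToFun` and `funToFin` identify subsets with the matrix indices in
-- `Fin (2 ^ n)`.
Subset : ℕ → Set
Subset = Vector (Fin 2)

χ : Fin 2 → ℚ
χ 0F = 0ℚ
χ 1F = 1ℚ

∣_∩_∣ : ∀ {n} → Subset n → Subset n → ℚ
∣ a ∩ b ∣ = (χ ∘ a) · (χ ∘ b)

∣∩∣-cong : ∀ {n} {a a′ b b′ : Subset n} → a ≗ a′ → b ≗ b′ →
  ∣ a ∩ b ∣ ≡ ∣ a′ ∩ b′ ∣
∣∩∣-cong a≗a′ b≗b′ = sum-cong-≗ λ i →
  cong₂ (λ s t → χ s ℚ.* χ t) (a≗a′ i) (b≗b′ i)

-- The sum over disjoint pairs (a, b).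
∑⊥ : ∀ n → (Subset n → Subset n → ℕ) → ℕ
∑⊥ zero    f = f [] []
∑⊥ (suc n) f = ∑⊥ n (λ a b → f (0F ∷ a) (0F ∷ b))
         ℕ.+ ∑⊥ n (λ a b → f (0F ∷ a) (1F ∷ b))
         ℕ.+ ∑⊥ n (λ a b → f (1F ∷ a) (0F ∷ b))

-- Prepending anything but a common element adds `0ℚ` to the intersection size, so every pair
-- reached by the recursion is disjoint.
∑⊥-mono : ∀ n {f g : Subset n → Subset n → ℕ} →
  (∀ a b → ∣ a ∩ b ∣ ≡ 0ℚ → f a b ℕ.≤ g a b) → ∑⊥ n f ℕ.≤ ∑⊥ n g
∑⊥-mono zero    f≤g = f≤g [] [] refl
∑⊥-mono (suc n) f≤g = ℕ.+-mono-≤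
  (ℕ.+-mono-≤ (∑⊥-mono n λ a b → f≤g _ _ ∘ trans (ℚ.+-identityˡ ∣ a ∩ b ∣))
              (∑⊥-mono n λ a b → f≤g _ _ ∘ trans (ℚ.+-identityˡ ∣ a ∩ b ∣)))
  (∑⊥-mono n λ a b → f≤g _ _ ∘ trans (ℚ.+-identityˡ ∣ a ∩ b ∣))

∑⊥-+ : ∀ n (f g : Subset n → Subset n → ℕ) →
  ∑⊥ n (λ a b → f a b ℕ.+ g a b) ≡ ∑⊥ n f ℕ.+ ∑⊥ n g
∑⊥-+ zero    f g = refl
∑⊥-+ (suc n) f g = trans
  (cong₂ ℕ._+_ (cong₂ ℕ._+_ (∑⊥-+ n _ _) (∑⊥-+ n _ _)) (∑⊥-+ n _ _))
  (solve 6 (λ a b c d e f → a :+ b :+ (c :+ d) :+ (e :+ f)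
                         := a :+ c :+ e :+ (b :+ d :+ f)) refl
    (∑⊥ n λ a b → f (0F ∷ a) (0F ∷ b)) (∑⊥ n λ a b → g (0F ∷ a) (0F ∷ b))
    (∑⊥ n λ a b → f (0F ∷ a) (1F ∷ b)) (∑⊥ n λ a b → g (0F ∷ a) (1F ∷ b))
    (∑⊥ n λ a b → f (1F ∷ a) (0F ∷ b)) (∑⊥ n λ a b → g (1F ∷ a) (0F ∷ b)))
  where open ℕ.+-*-Solver

-- Each element lies in `a` only, in `b` only or in neither, which makes 3ⁿ disjoint pairs.
∑⊥-const : ∀ n c → ∑⊥ n (λ _ _ → c) ≡ 3 ^ n ℕ.* c
∑⊥-const zero    c = sym (ℕ.+-identityʳ c)
∑⊥-const (suc n) c rewrite ∑⊥-const n c =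
  solve 2 (λ p c → p :* c :+ p :* c :+ p :* c := con 3 :* p :* c) refl (3 ^ n) c
  where open ℕ.+-*-Solver

-- The Kaibel-Weltge bound for a single rectangle

⟦_⟧ : Bool → ℕ
⟦ true  ⟧ = 1
⟦ false ⟧ = 0

⟦⟧≤1 : ∀ t → ⟦ t ⟧ ℕ.≤ 1
⟦⟧≤1 true  = ℕ.≤-refl
⟦⟧≤1 false = z≤n

AvoidsSingletons : ∀ {n} → (Subset n → Bool) → (Subset n → Bool) → Set
AvoidsSingletons A B = ∀ a b → T (A a) → T (B b) → ∣ a ∩ b ∣ ≢ 1ℚ

-- Split by membership of the first element into A₀, A₁, B₀, B₁.  Then
-- (A₀ ∪ A₁) × B₀ and A₀ × (B₀ ∪ B₁) still avoid singletons, and A₁ × B₁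
-- contains no disjoint pair; hence on disjoint pairs the indicators of A₀ × B₀,
-- A₀ × B₁ and A₁ × B₀ add up to no more than those of the two unions.
∑⊥-rectangle : ∀ n (A B : Subset n → Bool) → AvoidsSingletons A B →
  ∑⊥ n (λ a b → ⟦ A a ∧ B b ⟧) ℕ.≤ 2 ^ n
∑⊥-rectangle zero    A B avoids = ⟦⟧≤1 (A [] ∧ B [])
∑⊥-rectangle (suc n) A B avoids = begin
  ∑⊥ n (λ a b → ⟦ A₀ a ∧ B₀ b ⟧)
    ℕ.+ ∑⊥ n (λ a b → ⟦ A₀ a ∧ B₁ b ⟧)
    ℕ.+ ∑⊥ n (λ a b → ⟦ A₁ a ∧ B₀ b ⟧)
    ≡⟨ cong (ℕ._+ ∑⊥ n (λ a b → ⟦ A₁ a ∧ B₀ b ⟧)) (∑⊥-+ n _ _) ⟨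
  ∑⊥ n (λ a b → ⟦ A₀ a ∧ B₀ b ⟧ ℕ.+ ⟦ A₀ a ∧ B₁ b ⟧)
    ℕ.+ ∑⊥ n (λ a b → ⟦ A₁ a ∧ B₀ b ⟧)
    ≡⟨ ∑⊥-+ n _ _ ⟨
  ∑⊥ n (λ a b → ⟦ A₀ a ∧ B₀ b ⟧ ℕ.+ ⟦ A₀ a ∧ B₁ b ⟧ ℕ.+ ⟦ A₁ a ∧ B₀ b ⟧)
    ≤⟨ ∑⊥-mono n (λ a b a⊥b →
         pointwise (A₀ a) (A₁ a) (B₀ b) (B₁ b) λ A₁a B₁b →
         -- Adding a common first element to a disjoint pair gives a pair that meets in exactly that
         -- element.
         avoids (1F ∷ a) (1F ∷ b) A₁a B₁b (cong (1ℚ ℚ.+_) a⊥b)) ⟩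
  ∑⊥ n (λ a b → ⟦ (A₀ a ∨ A₁ a) ∧ B₀ b ⟧ ℕ.+ ⟦ A₀ a ∧ (B₀ b ∨ B₁ b) ⟧)
    ≡⟨ ∑⊥-+ n _ _ ⟩
  ∑⊥ n (λ a b → ⟦ (A₀ a ∨ A₁ a) ∧ B₀ b ⟧) ℕ.+ ∑⊥ n (λ a b → ⟦ A₀ a ∧ (B₀ b ∨ B₁ b) ⟧)
    ≤⟨ ℕ.+-mono-≤ (∑⊥-rectangle n (λ a → A₀ a ∨ A₁ a) B₀ avoidsˡ)
                  (∑⊥-rectangle n A₀ (λ b → B₀ b ∨ B₁ b) avoidsʳ) ⟩
  2 ^ n ℕ.+ 2 ^ n
    ≡⟨ cong (2 ^ n ℕ.+_) (ℕ.+-identityʳ (2 ^ n)) ⟨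
  2 ^ suc n ∎
  where
  open ℕ.≤-Reasoning
  A₀ A₁ B₀ B₁ : Subset n → Bool
  A₀ a = A (0F ∷ a)
  A₁ a = A (1F ∷ a)
  B₀ b = B (0F ∷ b)
  B₁ b = B (1F ∷ b)

  pointwise : ∀ a₀ a₁ b₀ b₁ → (T a₁ → T b₁ → ⊥) →
    ⟦ a₀ ∧ b₀ ⟧ ℕ.+ ⟦ a₀ ∧ b₁ ⟧ ℕ.+ ⟦ a₁ ∧ b₀ ⟧
      ℕ.≤ ⟦ (a₀ ∨ a₁) ∧ b₀ ⟧ ℕ.+ ⟦ a₀ ∧ (b₀ ∨ b₁) ⟧
  pointwise _     true  _     true  ¬both = ⊥-elim (¬both _ _)
  pointwise true  true  true  false _ = ℕ.≤-refl
  pointwise true  true  false false _ = ℕ.≤-refl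
  pointwise true  false true  true  _ = ℕ.≤-refl
  pointwise true  false false true  _ = ℕ.≤-refl
  -- The only strict case: of the three rectangles just `A₀ × B₀` contains the pair, but both unions
  -- contain it.
  pointwise true  false true  false _ = s≤s z≤n
  pointwise true  false false false _ = ℕ.≤-refl
  pointwise false true  true  false _ = ℕ.≤-refl
  pointwise false true  false false _ = ℕ.≤-refl
  pointwise false false _     _     _ = z≤n

  split-∨ : ∀ s {t} → T (s ∨ t) → T s ⊎ T t
  split-∨ true  h = inj₁ _
  split-∨ false h = inj₂ h

  avoidsˡ : AvoidsSingletons (λ a → A₀ a ∨ A₁ a) B₀
  avoidsˡ a b Aa Bb eq = [
      (λ A₀a → avoids (0F ∷ a) (0F ∷ b) A₀a Bb 0+eq) ,
      (λ A₁a → avoids (1F ∷ a) (0F ∷ b) A₁a Bb 0+eq) ]′ (split-∨ (A₀ a) Aa)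
    where 0+eq = trans (ℚ.+-identityˡ ∣ a ∩ b ∣) eq

  avoidsʳ : AvoidsSingletons A₀ (λ b → B₀ b ∨ B₁ b)
  avoidsʳ a b Aa Bb eq = [
      (λ B₀b → avoids (0F ∷ a) (0F ∷ b) Aa B₀b 0+eq) ,
      (λ B₁b → avoids (0F ∷ a) (1F ∷ b) Aa B₁b 0+eq) ]′ (split-∨ (B₀ b) Bb)
    where 0+eq = trans (ℚ.+-identityˡ ∣ a ∩ b ∣) eq

-- Covers of the disjoint pairs by rectangles

open SemiringSum ℕ.+-*-semiring using () renaming (sum to sumℕ)

sumℕ-lookup : ∀ {r} (f : Vector ℕ r) l → f l ℕ.≤ sumℕ f
sumℕ-lookup f zero    = ℕ.m≤m+n _ _
sumℕ-lookup f (suc l) = ℕ.≤-trans (sumℕ-lookup (f ∘ suc) l) (ℕ.m≤n+m _ _)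

∑⊥-rectangles : ∀ n r (A B : Fin r → Subset n → Bool) →
  (∀ l → AvoidsSingletons (A l) (B l)) →
  ∑⊥ n (λ a b → sumℕ λ l → ⟦ A l a ∧ B l b ⟧) ℕ.≤ r ℕ.* 2 ^ n
∑⊥-rectangles n zero    A B avoids =
  ℕ.≤-reflexive (trans (∑⊥-const n 0) (ℕ.*-zeroʳ (3 ^ n)))
∑⊥-rectangles n (suc r) A B avoids = ℕ.≤-trans
  (ℕ.≤-reflexive (∑⊥-+ n (λ a b → ⟦ A zero a ∧ B zero b ⟧) _))
  (ℕ.+-mono-≤ (∑⊥-rectangle n (A zero) (B zero) (avoids zero))
              (∑⊥-rectangles n r (A ∘ suc) (B ∘ suc) (avoids ∘ suc)))

-- Double counting: the indicators of the rectangles add up to at least 1 at each of the 3ⁿ disjoint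
-- pairs, and each rectangle contributes at most 2ⁿ in total.
rectangle-cover : ∀ n r (A B : Fin r → Subset n → Bool) →
  (∀ l → AvoidsSingletons (A l) (B l)) →
  (∀ a b → ∣ a ∩ b ∣ ≡ 0ℚ → ∃[ l ] (T (A l a) × T (B l b))) →
  3 ^ n ℕ.≤ r ℕ.* 2 ^ n
rectangle-cover n r A B avoids covers = begin
  3 ^ n                   ≡⟨ ℕ.*-identityʳ (3 ^ n) ⟨
  3 ^ n ℕ.* 1             ≡⟨ ∑⊥-const n 1 ⟨
  ∑⊥ n (λ _ _ → 1)        ≤⟨ ∑⊥-mono n covered ⟩
  ∑⊥ n (λ a b → sumℕ λ l → ⟦ A l a ∧ B l b ⟧)
                          ≤⟨ ∑⊥-rectangles n r A B avoids ⟩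
  r ℕ.* 2 ^ n             ∎
  where
  open ℕ.≤-Reasoning
  both : ∀ s t → T s → T t → 1 ℕ.≤ ⟦ s ∧ t ⟧
  both true true _ _ = ℕ.≤-refl

  covered : ∀ a b → ∣ a ∩ b ∣ ≡ 0ℚ → 1 ℕ.≤ sumℕ λ l → ⟦ A l a ∧ B l b ⟧
  covered a b a⊥b with l , Aa , Bb ← covers a b a⊥b =
    ℕ.≤-trans (both (A l a) (B l b) Aa Bb)
              (sumℕ-lookup (λ l → ⟦ A l a ∧ B l b ⟧) l)

^-distribʳ-* : ∀ m n o → (m ℕ.* n) ^ o ≡ m ^ o ℕ.* n ^ o
^-distribʳ-* m n zero    = refl
^-distribʳ-* m n (suc o) rewrite ^-distribʳ-* m n o =
  solve 4 (λ m n p q → m :* n :* (p :* q) := m :* p :* (n :* q)) refl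
    m n (m ^ o) (n ^ o)
  where open ℕ.+-*-Solver

-- Squaring the hypothesis gives 9ⁿ ≤ r² 4ⁿ, while 2ⁿ 4ⁿ = 8ⁿ ≤ 9ⁿ; then 4ⁿ cancels.
3^n≤r*2^n⇒2^n≤r^2 : ∀ n r → 3 ^ n ℕ.≤ r ℕ.* 2 ^ n → 2 ^ n ℕ.≤ r ^ 2
3^n≤r*2^n⇒2^n≤r^2 n r 3ⁿ≤ = ℕ.*-cancelʳ-≤ (2 ^ n) (r ^ 2) (4 ^ n)
  {{ℕ.m^n≢0 4 n}} (begin
    2 ^ n ℕ.* 4 ^ n             ≡⟨ ^-distribʳ-* 2 4 n ⟨
    8 ^ n                       ≤⟨ ℕ.^-monoˡ-≤ n (ℕ.n≤1+n 8) ⟩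
    9 ^ n                       ≡⟨ ^-distribʳ-* 3 3 n ⟩
    3 ^ n ℕ.* 3 ^ n             ≤⟨ ℕ.*-mono-≤ 3ⁿ≤ 3ⁿ≤ ⟩
    r ℕ.* 2 ^ n ℕ.* (r ℕ.* 2 ^ n)
      ≡⟨ solve 2 (λ r p → r :* p :* (r :* p) := r :^ 2 :* (p :* p)) refl r (2 ^ n) ⟩
    r ^ 2 ℕ.* (2 ^ n ℕ.* 2 ^ n) ≡⟨ cong (r ^ 2 ℕ.*_) (^-distribʳ-* 2 2 n) ⟨
    r ^ 2 ℕ.* 4 ^ n             ∎)
  where
  open ℕ.≤-Reasoning
  open ℕ.+-*-Solver

-- Positive and null reals

Eventually : (ℕ → Set) → Set
Eventually P = ∃[ N ] (∀ n → N ℕ.≤ n → P n)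

eventually₂ : ∀ {P Q R : ℕ → Set} → (∀ n → P n → Q n → R n) →
  Eventually P → Eventually Q → Eventually R
eventually₂ f (K , p) (L , q) = K ℕ.⊔ L , λ n K⊔L≤n →
  f n (p n (ℕ.m⊔n≤o⇒m≤o K L K⊔L≤n)) (q n (ℕ.m⊔n≤o⇒n≤o K L K⊔L≤n))

eventually-witness : ∀ {P : ℕ → Set} → Eventually P → ∃[ n ] P n
eventually-witness (N , p) = N , p N ℕ.≤-refl

-- Constructive positivity asks for a rational bound away from zero, since positive terms alone
-- could tend to zero.
0<_ : ℝ → Set
0< x = ∃[ ε ] Positive ε × Eventually λ n → ε ℚ.≤ seq x n

-- Equivalent to `x ≃ 0ℝ`, but bounding `seq x n` itself spares the subtraction of zero.
Null : ℝ → Set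
Null x = ∀ ε → Positive ε → Eventually λ n → ∣ seq x n ∣ ℚ.< ε

half-pos : ∀ ε → Positive ε → Positive (½ ℚ.* ε)
half-pos ε ε>0 = ℚ.pos*pos⇒pos ½ ε {{ε>0}}

halves : ∀ ε → ½ ℚ.* ε ℚ.+ ½ ℚ.* ε ≡ ε
halves ε = trans (sym (ℚ.*-distribʳ-+ ε ½ ½)) (ℚ.*-identityˡ ε)

<⇒≱ : ∀ {p q} → p ℚ.< q → ¬ q ℚ.≤ p
<⇒≱ p<q q≤p = ℚ.<-irrefl refl (ℚ.<-≤-trans p<q q≤p)

p≤∣p∣ : ∀ p → p ℚ.≤ ∣ p ∣
p≤∣p∣ p with ℚ.≤-total 0ℚ p
... | inj₁ 0≤p = ℚ.≤-reflexive (sym (ℚ.0≤p⇒∣p∣≡p 0≤p))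
... | inj₂ p≤0 = ℚ.≤-trans p≤0 (ℚ.0≤∣p∣ p)

-p≤∣p∣ : ∀ p → ℚ.- p ℚ.≤ ∣ p ∣
-p≤∣p∣ p = subst (ℚ.- p ℚ.≤_) (ℚ.∣-p∣≡∣p∣ p) (p≤∣p∣ (ℚ.- p))

∣p∣<-intro : ∀ {p ε} → p ℚ.< ε → 0ℚ ℚ.< p ℚ.+ ε → ∣ p ∣ ℚ.< ε
∣p∣<-intro {p} {ε} p<ε 0<p+ε with ℚ.∣p∣≡p∨∣p∣≡-p p
... | inj₁ eq = subst (ℚ._< ε) (sym eq) p<ε
... | inj₂ eq = subst (ℚ._< ε) (sym eq) (begin-strict
  ℚ.- p                ≡⟨ ℚ.+-identityʳ (ℚ.- p) ⟨
  ℚ.- p ℚ.+ 0ℚ         <⟨ ℚ.+-monoʳ-< (ℚ.- p) 0<p+ε ⟩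
  ℚ.- p ℚ.+ (p ℚ.+ ε)  ≡⟨ solve 2 (λ p e → :- p :+ (p :+ e) := e) refl p ε ⟩
  ε                    ∎)
  where
  open ℚ.≤-Reasoning
  open ℚ.+-*-Solver

∣p∣<⇒0<p+ : ∀ p ε → ∣ p ∣ ℚ.< ε → 0ℚ ℚ.< p ℚ.+ ε
∣p∣<⇒0<p+ p ε |p|<ε = subst (ℚ._< p ℚ.+ ε) (ℚ.+-inverseʳ p)
  (ℚ.+-monoʳ-< p (ℚ.≤-<-trans (-p≤∣p∣ p) |p|<ε))

0<⇒0≤ : ∀ {x} → 0< x → 0ℝ ≤ x
0<⇒0≤ (δ , δ>0 , N , δ≤x) ε = N , λ n N≤n →
  ℚ.+-mono-< (ℚ.<-≤-trans (ℚ.positive⁻¹ δ {{δ>0}}) (δ≤x n N≤n)) (ℚ.positive⁻¹ ε)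

-- The argument Positive ε of _≤_ is irrelevant, so it is rebuilt from 0 < ε.
Null⇒0≤ : ∀ {x} → Null x → 0ℝ ≤ x
Null⇒0≤ {x} null ε with N , h ← null ε (ℚ.positive (ℚ.positive⁻¹ ε)) =
  N , λ n N≤n → ∣p∣<⇒0<p+ (seq x n) ε (h n N≤n)

-- Meant for terms `p` and `q` of a Cauchy sequence beyond its modulus for `δ`: one large term keeps
-- all the others away from zero.
stays-large : ∀ p q δ → δ ℚ.+ δ ℚ.≤ p → ∣ p ℚ.- q ∣ ℚ.< δ → δ ℚ.≤ q
stays-large p q δ 2δ≤p |p-q|<δ = begin
  δ
    ≡⟨ solve 1 (λ d → d := d :+ d :- d) refl δ ⟩
  δ ℚ.+ δ ℚ.- δ
    ≤⟨ ℚ.+-mono-≤ 2δ≤p (ℚ.neg-antimono-≤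
         (ℚ.<⇒≤ (ℚ.≤-<-trans (p≤∣p∣ (p ℚ.- q)) |p-q|<δ))) ⟩
  p ℚ.- (p ℚ.- q)
    ≡⟨ solve 2 (λ p q → p :- (p :- q) := q) refl p q ⟩
  q ∎
  where
  open ℚ.≤-Reasoning
  open ℚ.+-*-Solver

-- If a term beyond the modulus for ε/2 were at least ε, all terms beyond it would be at least ε/2,
-- contradicting `¬ 0< x`. The lower bound on the terms comes from `0ℝ ≤ x`. Comparison of rationals
-- is decidable, so no classical principle enters.
0≤∧≮⇒Null : ∀ {x} → 0ℝ ≤ x → ¬ 0< x → Null x
0≤∧≮⇒Null {x} 0≤x x≯0 ε ε>0
  with K , close ← cauchy x (½ ℚ.* ε) {{half-pos ε ε>0}}
  with L , 0<x+ε ← 0≤x ε {{ε>0}}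
  = K ℕ.⊔ L , λ n K⊔L≤n →
    let K≤n = ℕ.m⊔n≤o⇒m≤o K L K⊔L≤n
        L≤n = ℕ.m⊔n≤o⇒n≤o K L K⊔L≤n
    in ∣p∣<-intro
      (ℚ.≰⇒> λ ε≤xₙ → x≯0 (½ ℚ.* ε , half-pos ε ε>0 , K , λ m K≤m →
        stays-large (seq x n) (seq x m) (½ ℚ.* ε)
          (subst (ℚ._≤ seq x n) (sym (halves ε)) ε≤xₙ) (close n m K≤n K≤m)))
      (0<x+ε n L≤n)

0≤-+ : ∀ {x y} → 0ℝ ≤ x → 0ℝ ≤ y → 0ℝ ≤ x + y
0≤-+ {x} {y} 0≤x 0≤y ε = eventually₂
  (λ n 0<x 0<y → subst (0ℚ ℚ.<_)
    (trans (rearrange (seq x n) (seq y n) (½ ℚ.* ε))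
           (cong (seq x n ℚ.+ seq y n ℚ.+_) (halves ε)))
    (ℚ.+-mono-< 0<x 0<y))
  (0≤x (½ ℚ.* ε) {{ℚ.pos*pos⇒pos ½ ε}}) (0≤y (½ ℚ.* ε) {{ℚ.pos*pos⇒pos ½ ε}})
  where
  open ℚ.+-*-Solver
  rearrange : ∀ p q δ → p ℚ.+ δ ℚ.+ (q ℚ.+ δ) ≡ p ℚ.+ q ℚ.+ (δ ℚ.+ δ)
  rearrange = solve 3 (λ p q d → p :+ d :+ (q :+ d) := p :+ q :+ (d :+ d)) refl

-- Half of the lower bound for `x` absorbs the amount by which terms of `y` may still fall below
-- zero.
0<-+ˡ : ∀ {x y} → 0< x → 0ℝ ≤ y → 0< (x + y)
0<-+ˡ {x} {y} (ε , ε>0 , ε≤x) 0≤y = ½ ℚ.* ε , half-pos ε ε>0 , eventually₂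
  (λ n ε≤xₙ 0<yₙ+½ε → begin
    ½ ℚ.* ε
      ≡⟨ ℚ.+-identityʳ (½ ℚ.* ε) ⟨
    ½ ℚ.* ε ℚ.+ 0ℚ
      ≤⟨ ℚ.+-monoʳ-≤ (½ ℚ.* ε) (ℚ.<⇒≤ 0<yₙ+½ε) ⟩
    ½ ℚ.* ε ℚ.+ (seq y n ℚ.+ ½ ℚ.* ε)
      ≡⟨ rearrange (½ ℚ.* ε) (seq y n) ⟩
    ½ ℚ.* ε ℚ.+ ½ ℚ.* ε ℚ.+ seq y n
      ≡⟨ cong (ℚ._+ seq y n) (halves ε) ⟩
    ε ℚ.+ seq y n
      ≤⟨ ℚ.+-monoˡ-≤ (seq y n) ε≤xₙ ⟩
    seq x n ℚ.+ seq y n ∎)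
  ε≤x (0≤y (½ ℚ.* ε) {{half-pos ε ε>0}})
  where
  open ℚ.≤-Reasoning
  open ℚ.+-*-Solver
  rearrange : ∀ δ p → δ ℚ.+ (p ℚ.+ δ) ≡ δ ℚ.+ δ ℚ.+ p
  rearrange = solve 2 (λ d p → d :+ (p :+ d) := d :+ d :+ p) refl

0<-resp : ∀ {x y} → (∀ n → seq x n ≡ seq y n) → 0< x → 0< y
0<-resp eq (ε , ε>0 , N , ε≤x) =
  ε , ε>0 , N , λ n N≤n → subst (ε ℚ.≤_) (eq n) (ε≤x n N≤n)

0<-+ʳ : ∀ {x y} → 0ℝ ≤ x → 0< y → 0< (x + y)
0<-+ʳ {x} {y} 0≤x 0<y = 0<-resp {y + x} {x + y}
  (λ n → ℚ.+-comm (seq y n) (seq x n)) (0<-+ˡ {y} {x} 0<y 0≤x)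

0≤-sum : ∀ {r} (f : Vector ℝ r) → (∀ l → 0ℝ ≤ f l) → 0ℝ ≤ sum f
0≤-sum {zero}  f 0≤f = pointwise⇒0≤ {0ℝ} λ _ → ℚ.≤-refl
0≤-sum {suc r} f 0≤f =
  0≤-+ {f zero} {sum (f ∘ suc)} (0≤f zero) (0≤-sum (f ∘ suc) (0≤f ∘ suc))

0<-sum : ∀ {r} (f : Vector ℝ r) → (∀ l → 0ℝ ≤ f l) → ∀ l → 0< f l → 0< sum f
0<-sum f 0≤f zero    0<fl =
  0<-+ˡ {f zero} {sum (f ∘ suc)} 0<fl (0≤-sum (f ∘ suc) (0≤f ∘ suc))
0<-sum f 0≤f (suc l) 0<fl =
  0<-+ʳ {f zero} {sum (f ∘ suc)} (0≤f zero) (0<-sum (f ∘ suc) (0≤f ∘ suc) l 0<fl)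

0<-* : ∀ {x y} → 0< x → 0< y → 0< (x * y)
0<-* {x} {y} (δ , δ>0 , δ≤x) (ε , ε>0 , ε≤y) =
  δ ℚ.* ε , ℚ.pos*pos⇒pos δ {{δ>0}} ε {{ε>0}} , eventually₂
  (λ n δ≤xₙ ε≤yₙ → ℚ.≤-trans
    (ℚ.*-monoʳ-≤-nonNeg ε {{ℚ.pos⇒nonNeg ε {{ε>0}}}} δ≤xₙ)
    (ℚ.*-monoˡ-≤-nonNeg (seq x n)
      {{ℚ.nonNegative (ℚ.≤-trans (ℚ.<⇒≤ (ℚ.positive⁻¹ δ {{δ>0}})) δ≤xₙ)}} ε≤yₙ))
  δ≤x ε≤y

Null-+ : ∀ {x y} → Null x → Null y → Null (x + y)
Null-+ {x} {y} null-x null-y ε ε>0 = eventually₂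
  (λ n |x|< |y|< → ℚ.≤-<-trans (ℚ.∣p+q∣≤∣p∣+∣q∣ (seq x n) (seq y n))
    (subst (∣ seq x n ∣ ℚ.+ ∣ seq y n ∣ ℚ.<_) (halves ε) (ℚ.+-mono-< |x|< |y|<)))
  (null-x (½ ℚ.* ε) (half-pos ε ε>0)) (null-y (½ ℚ.* ε) (half-pos ε ε>0))

Null-sum : ∀ {r} (f : Vector ℝ r) → (∀ l → Null (f l)) → Null (sum f)
Null-sum {zero}  f null ε ε>0 = 0 , λ _ _ → ℚ.positive⁻¹ ε {{ε>0}}
Null-sum {suc r} f null =
  Null-+ {f zero} {sum (f ∘ suc)} (null zero) (Null-sum (f ∘ suc) (null ∘ suc))

split : ∀ p q → p ≡ p ℚ.- q ℚ.+ q
split = solve 2 (λ p q → p := p :- q :+ q) refl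
  where open ℚ.+-*-Solver

bounded : ∀ x → ∃[ B ] Positive B × Eventually λ n → ∣ seq x n ∣ ℚ.≤ B
bounded x = let N , close = cauchy x 1ℚ in
  1ℚ ℚ.+ ∣ seq x N ∣ ,
  ℚ.pos+nonNeg⇒pos 1ℚ ∣ seq x N ∣ {{ℚ.∣-∣-nonNeg (seq x N)}} ,
  N , λ n N≤n → begin
    ∣ seq x n ∣
      ≡⟨ cong ∣_∣ (split (seq x n) (seq x N)) ⟩
    ∣ seq x n ℚ.- seq x N ℚ.+ seq x N ∣
      ≤⟨ ℚ.∣p+q∣≤∣p∣+∣q∣ (seq x n ℚ.- seq x N) (seq x N) ⟩
    ∣ seq x n ℚ.- seq x N ∣ ℚ.+ ∣ seq x N ∣
      ≤⟨ ℚ.+-monoˡ-≤ ∣ seq x N ∣ (ℚ.<⇒≤ (close n N N≤n ℕ.≤-refl)) ⟩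
    1ℚ ℚ.+ ∣ seq x N ∣ ∎
  where open ℚ.≤-Reasoning

Null-*-bounded : ∀ {x} y → Null x → ∀ B → Positive B →
  Eventually (λ n → ∣ seq y n ∣ ℚ.≤ B) → Null (x * y)
Null-*-bounded {x} y null B B>0 |y|≤B ε ε>0 = eventually₂
  (λ n |x|< |y|≤ → begin-strict
    ∣ seq x n ℚ.* seq y n ∣
      ≡⟨ ℚ.∣p*q∣≡∣p∣*∣q∣ (seq x n) (seq y n) ⟩
    ∣ seq x n ∣ ℚ.* ∣ seq y n ∣
      ≤⟨ ℚ.*-monoˡ-≤-nonNeg (∣ seq x n ∣) {{ℚ.∣-∣-nonNeg (seq x n)}} |y|≤ ⟩
    ∣ seq x n ∣ ℚ.* B
      <⟨ ℚ.*-monoˡ-<-pos B {{B>0}} |x|< ⟩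
    ε ℚ.* 1/B ℚ.* B
      ≡⟨ ℚ.*-assoc ε 1/B B ⟩
    ε ℚ.* (1/B ℚ.* B)
      ≡⟨ cong (ε ℚ.*_) (ℚ.*-inverseˡ B {{ℚ.pos⇒nonZero B {{B>0}}}}) ⟩
    ε ℚ.* 1ℚ
      ≡⟨ ℚ.*-identityʳ ε ⟩
    ε ∎)
  (null (ε ℚ.* 1/B) (ℚ.pos*pos⇒pos ε {{ε>0}} 1/B {{ℚ.1/pos⇒pos B {{B>0}}}})) |y|≤B
  where
  open ℚ.≤-Reasoning
  1/B : ℚ
  1/B = (ℚ.1/ B) {{ℚ.pos⇒nonZero B {{B>0}}}}

Null-*ˡ : ∀ {x} y → Null x → Null (x * y)
Null-*ˡ {x} y null =
  let B , B>0 , |y|≤B = bounded y in Null-*-bounded {x} y null B B>0 |y|≤B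

Null-*ʳ : ∀ x {y} → Null y → Null (x * y)
Null-*ʳ x {y} null ε ε>0 =
  let N , h = Null-*ˡ {y} x null ε ε>0 in
  N , λ n N≤n → subst (λ p → ∣ p ∣ ℚ.< ε) (ℚ.*-comm (seq y n) (seq x n)) (h n N≤n)

≃0⇒≯0 : ∀ {x} → 0ℝ ≃ x → ¬ 0< x
≃0⇒≯0 {x} 0≃x (ε , ε>0 , ε≤x) =
  let n , ε≤xₙ , |0-xₙ|<ε = eventually-witness
        (eventually₂ (λ _ → _,_) ε≤x (0≃x ε {{ε>0}}))
  in <⇒≱ |0-xₙ|<ε (begin
    ε                   ≤⟨ ε≤xₙ ⟩
    seq x n             ≤⟨ p≤∣p∣ (seq x n) ⟩
    ∣ seq x n ∣         ≡⟨ ℚ.∣-p∣≡∣p∣ (seq x n) ⟨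
    ∣ ℚ.- seq x n ∣     ≡⟨ cong ∣_∣ (ℚ.+-identityˡ (ℚ.- seq x n)) ⟨
    ∣ 0ℚ ℚ.- seq x n ∣  ∎)
  where open ℚ.≤-Reasoning

≃1⇒¬Null : ∀ {x} → 1ℝ ≃ x → ¬ Null x
≃1⇒¬Null {x} 1≃x null =
  let n , |1-xₙ|<½ , |xₙ|<½ = eventually-witness
        (eventually₂ (λ _ → _,_) (1≃x ½) (null ½ _))
  -- Since `½ + ½` evaluates to `1ℚ`, the two strict bounds contradict the triangle inequality.
  in <⇒≱ (ℚ.+-mono-< |1-xₙ|<½ |xₙ|<½) (begin
    1ℚ                                  ≡⟨ split 1ℚ (seq x n) ⟩
    1ℚ ℚ.- seq x n ℚ.+ seq x n          ≤⟨ p≤∣p∣ _ ⟩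
    ∣ 1ℚ ℚ.- seq x n ℚ.+ seq x n ∣      ≤⟨ ℚ.∣p+q∣≤∣p∣+∣q∣ (1ℚ ℚ.- seq x n) (seq x n) ⟩
    ∣ 1ℚ ℚ.- seq x n ∣ ℚ.+ ∣ seq x n ∣  ∎)
  where open ℚ.≤-Reasoning

-- The matrix

slack : ∀ {n} → Subset n → Subset n → ℚ
slack a b = 1ℚ ℚ.- ∣ a ∩ b ∣

squaredSlack : ∀ n → Matrix (2 ^ n) (2 ^ n)
squaredSlack n i j = fromℚ (s ℚ.* s)
  where s = slack {n} (finToFun i) (finToFun j)

squaredSlack-nonnegative : ∀ n → Nonnegative (squaredSlack n)
squaredSlack-nonnegative n i j = pointwise⇒0≤ {squaredSlack n i j} λ _ →
  0≤p*p (slack {n} (finToFun i) (finToFun j))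

squaredSlack-psd : ∀ n → PSDFactorization (squaredSlack n) (suc n)
squaredSlack-psd n = record
  { T          = λ i → outer (v i)
  ; U          = λ j → outer (w j)
  ; T-psd      = λ i → outer-psd (v i)
  ; U-psd      = λ j → outer-psd (w j)
  ; factorizes = λ i j → subst
      (λ s → trace (outer (v i) ⊗ outer (w j)) ≃ fromℚ (s ℚ.* s))
      -- The leading ones contribute `1ℚ` to `v i · w j`; pulling the sign out of the rest turns it
      -- into the slack.
      (cong (1ℚ ℚ.+_) (·-negˡ (χ ∘ finToFun {2} {n} i) (χ ∘ finToFun {2} {n} j)))
      (trace-outer (v i) (w j))
  }
  where
  v w : Fin (2 ^ n) → Vector ℚ (suc n)
  v i = 1ℚ ∷ (ℚ.-_ ∘ χ ∘ finToFun {2} {n} i)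
  w j = 1ℚ ∷ (χ ∘ finToFun {2} {n} j)

-- Decoding an encoded subset returns it only up to pointwise equality, which the intersection size
-- respects.
squaredSlack-funToFin : ∀ {n} (a b : Subset n) {q} → ∣ a ∩ b ∣ ≡ q →
  squaredSlack n (funToFin a) (funToFin b) ≡ fromℚ ((1ℚ ℚ.- q) ℚ.* (1ℚ ℚ.- q))
squaredSlack-funToFin a b eq =
  cong (λ q → fromℚ ((1ℚ ℚ.- q) ℚ.* (1ℚ ℚ.- q)))
    (trans (∣∩∣-cong (finToFun-funToFin a) (finToFun-funToFin b)) eq)

-- From a nonnegative factorization to a rectangle cover

module _ n r (F : NonnegativeFactorization (squaredSlack n) r) where
  open NonnegativeFactorization F renaming (T to P; U to Q)

  -- Rectangle `l` is the support of column `l` of `P` times the support of row `l` of `Q`. It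
  -- cannot contain a zero entry, since one positive summand makes the sum positive; and an entry 1
  -- lies in some rectangle, since it is not a sum of null terms.
  cover-bound : (∀ i l → Dec (0< P i l)) → (∀ l j → Dec (0< Q l j)) →
    3 ^ n ℕ.≤ r ℕ.* 2 ^ n
  cover-bound 0<P? 0<Q? = rectangle-cover n r
    (λ l a → does (0<P? (funToFin a) l)) (λ l b → does (0<Q? l (funToFin b)))
    avoids covers
    where
    sound : ∀ {A : Set} (A? : Dec A) → T (does A?) → A
    sound (yes a) _ = a

    complete : ∀ {A : Set} (A? : Dec A) → A → T (does A?)
    complete (yes _) _ = _
    complete (no ¬a) a = ¬a a

    -- A nonnegative factor that is not positive is null, and then so is the product, because the
    -- other factor is bounded.
    term-dichotomy : ∀ i l j → (0< P i l × 0< Q l j) ⊎ Null (P i l * Q l j)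
    term-dichotomy i l j with 0<P? i l | 0<Q? l j
    ... | yes 0<P | yes 0<Q = inj₁ (0<P , 0<Q)
    ... | no  P≯0 | _       = inj₂ (Null-*ˡ {P i l} (Q l j)
      (0≤∧≮⇒Null {P i l} (T-nonnegative i l) P≯0))
    ... | _       | no Q≯0  = inj₂ (Null-*ʳ (P i l) {Q l j}
      (0≤∧≮⇒Null {Q l j} (U-nonnegative l j) Q≯0))

    -- Read off from the dichotomy, as positive and null reals are both nonnegative.
    0≤term : ∀ i l j → 0ℝ ≤ P i l * Q l j
    0≤term i l j with term-dichotomy i l j
    ... | inj₁ (0<P , 0<Q) = 0<⇒0≤ {P i l * Q l j} (0<-* {P i l} {Q l j} 0<P 0<Q)
    ... | inj₂ null        = Null⇒0≤ {P i l * Q l j} null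

    avoids : ∀ l → AvoidsSingletons _ _
    avoids l a b Pa Qb a∩b≡1 = ≃0⇒≯0 {(P ⊗ Q) i j}
      (subst (_≃ (P ⊗ Q) i j) (squaredSlack-funToFin a b a∩b≡1) (factorizes i j))
      (0<-sum (λ l → P i l * Q l j) (λ l → 0≤term i l j) l
        (0<-* {P i l} {Q l j} (sound (0<P? i l) Pa) (sound (0<Q? l j) Qb)))
      where
      i = funToFin a
      j = funToFin b

    covers : ∀ a b → ∣ a ∩ b ∣ ≡ 0ℚ → _
    covers a b a⊥b
      with any? (λ l → 0<P? (funToFin a) l ×-dec 0<Q? l (funToFin b))
    ... | yes (l , 0<P , 0<Q) = l , complete (0<P? _ l) 0<P , complete (0<Q? l _) 0<Q
    ... | no none = ⊥-elim (≃1⇒¬Null {(P ⊗ Q) i j}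
      (subst (_≃ (P ⊗ Q) i j) (squaredSlack-funToFin a b a⊥b) (factorizes i j))
      (Null-sum (λ l → P i l * Q l j) λ l →
        [ (λ both → ⊥-elim (none (l , both))) , (λ null → null) ]′
          (term-dichotomy i l j)))
      where
      i = funToFin a
      j = funToFin b

-- Positivity of reals is undecidable, but only finitely many instances are
-- needed and the conclusion is a decidable inequality of naturals, so they may
-- be decided under a double negation.
squaredSlack-rank₊ : ∀ n r → NonnegativeFactorization (squaredSlack n) r →
  2 ^ n ℕ.≤ r ^ 2
squaredSlack-rank₊ n r F = 3^n≤r*2^n⇒2^n≤r^2 n r
  (decidable-stable (3 ^ n ℕ.≤? r ℕ.* 2 ^ n) λ ¬bound →
    ¬¬dec P λ 0<P? → ¬¬dec Q λ 0<Q? → ¬bound (cover-bound n r F 0<P? 0<Q?))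
  where
  open NonnegativeFactorization F using () renaming (T to P; U to Q)
  ¬¬dec : ∀ {k m} (A : Matrix k m) → ¬ ¬ (∀ i j → Dec (0< A i j))
  -- Double negation is an applicative functor, so it can be pulled out of a quantifier over a
  -- finite set.
  ¬¬dec A = sequence applicative λ i → sequence applicative λ j → ¬¬-excluded-middle
    where applicative = RawMonad.rawApplicative ¬¬-Monad

corollary19 : Σ[ M ∈ MatrixFamily ]
    (∀ n → .{{_ : NonZero n}} → Nonnegative (M n))
    × Rank₊=2^Ω[n] M
    × RankPSD=O[n] M
corollary19 =
    (λ n → squaredSlack n)
  , (λ n → squaredSlack-nonnegative n)
  -- Here a = 1 and b = 2, so the constant in the exponent is c = 1/2, valid from n₀ = 0 on.
  , (1 , 2 , 0 , _ , _ , λ n _ r F →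
      subst (λ k → 2 ^ k ℕ.≤ r ^ 2) (sym (ℕ.*-identityˡ n)) (squaredSlack-rank₊ n r F))
  -- The constant 2 absorbs the extra dimension: n + 1 ≤ 2n because n ≥ 1.
  , (2 , 0 , λ n _ → suc n , squaredSlack-psd n , (begin
      1 ℕ.+ n        ≤⟨ ℕ.+-monoˡ-≤ n (ℕ.>-nonZero⁻¹ n) ⟩
      n ℕ.+ n        ≡⟨ cong (n ℕ.+_) (ℕ.+-identityʳ n) ⟨
      2 ℕ.* n        ∎))
  where open ℕ.≤-Reasoning
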